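{- Let $\mathcal{H}$ be a $q$-uniform linear hypergraph on $[n]$ that is maximal (i.e. no edge can be added to $\mathcal{H}$ while maintaining linearity). Then $$e(\mathcal{H}) \ge \frac{n(n-q+1)}{q(q-1)^2}=\frac{n^2}{q^3}(1-o(1)).$$
   Context: $[n]=\{1,\dots,n\}$, and $q\ge 2$ is an integer that may depend on $n$. A $q$-uniform hypergraph on $[n]$ is a set of $q$-element subsets of $[n]$, called edges; $e(\mathcal{H})$ is the number of edges of $\mathcal{H}$. A hypergraph is linear if any two distinct edges $A,B$ satisfy $|A\cap B|\le 1$. The $o(1)$ notation refers to $n\to\infty$.
   Formalization: The equality with n²/q³(1−o(1)) is false for general q (q=2 gives ratio 4), so it is stated only when q→∞ and q=o(n), exactly when it holds; the bound e(H) ≥ n²/q³(1−o(1)) is also given for all q=o(n). -}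

module Defs where

open import Data.Fin.Subset using (Subset; _∩_; ∣_∣)
open import Data.Integer as ℤ using (+_; 1ℤ)
open import Data.List using (List; _∷_; length)
open import Data.List.Membership.Propositional using (_∈_; _∉_)
open import Data.List.Relation.Unary.All using (All)
open import Data.List.Relation.Unary.Unique.Propositional using (Unique)
open import Data.Nat using (ℕ; NonZero; NonTrivial; _*_; _∸_; _^_; _≤_; _≥_; nonTrivial⇒n>1; nonTrivial⇒nonZero; >-nonZero)
open import Data.Nat.Properties using (m*n≢0; m^n≢0; m<n⇒0<n∸m)
open import Data.Product using (∃-syntax; _×_)
open import Data.Rational as ℚ using (ℚ; 0ℚ; 1ℚ; _/_)
open import Relation.Binary.PropositionalEquality using (_≡_; _≢_)
open import Relation.Nullary using (¬_)

-- The vertex set [n] is Fin n.  A finite set of edges is a repetition-free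
-- list, so the number of edges is the length of the list.
record Hypergraph (q n : ℕ) : Set where
  field
    edges   : List (Subset n)
    unique  : Unique edges
    uniform : All (λ A → ∣ A ∣ ≡ q) edges

open Hypergraph public

e : ∀ {q n} → Hypergraph q n → ℕ
e H = length (edges H)

Linear : ∀ {n} → List (Subset n) → Set
Linear E = ∀ {A B} → A ∈ E → B ∈ E → A ≢ B → ∣ A ∩ B ∣ ≤ 1

MaximalLinear : ∀ {q n} → Hypergraph q n → Set
MaximalLinear {q} {n} H =
  Linear (edges H) ×
  (∀ (A : Subset n) → ∣ A ∣ ≡ q → A ∉ edges H → ¬ Linear (A ∷ edges H))

ℕ→ℚ : ℕ → ℚ
ℕ→ℚ m = + m / 1

-- n (n - q + 1) / (q (q - 1)²).  The numerator is computed in ℤ, since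
-- n - q + 1 is negative when q > n + 1; the truncated q ∸ 1 is exact as q ≥ 2.
bound : (q n : ℕ) .{{_ : NonTrivial q}} → ℚ
bound q n = (+ n ℤ.* (+ n ℤ.- + q ℤ.+ 1ℤ)) / (q * (q ∸ 1) ^ 2)
  where
  instance
    q≢0 : NonZero q
    q≢0 = nonTrivial⇒nonZero q
    q-1≢0 : NonZero (q ∸ 1)
    q-1≢0 = >-nonZero (m<n⇒0<n∸m (nonTrivial⇒n>1 q))
    [q-1]²≢0 : NonZero ((q ∸ 1) ^ 2)
    [q-1]²≢0 = m^n≢0 (q ∸ 1) 2
    denominator≢0 : NonZero (q * (q ∸ 1) ^ 2)
    denominator≢0 = m*n≢0 q ((q ∸ 1) ^ 2)

n²/q³ : (q n : ℕ) .{{_ : NonTrivial q}} → ℚ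
n²/q³ q n = + (n ^ 2) / (q ^ 3)
  where
  instance
    q³≢0 : NonZero (q ^ 3)
    q³≢0 = m^n≢0 q 3 {{nonTrivial⇒nonZero q}}

-- f(n) = o(g(n)) as n → ∞.
LittleO : (f g : ℕ → ℚ) → Set
LittleO f g =
  ∀ (ε : ℚ) → 0ℚ ℚ.< ε →
  ∃[ N ] ∀ n → n ≥ N → ℚ.∣ f n ∣ ℚ.≤ ε ℚ.* ℚ.∣ g n ∣

o[1] : (ℕ → ℚ) → Set
o[1] δ = LittleO δ (λ _ → 1ℚ)

TendsToInfinity : (ℕ → ℕ) → Set
TendsToInfinity f = ∀ K → ∃[ N ] ∀ n → n ≥ N → f n ≥ K

{-# OPTIONS --safe #-}

-- Call a pair of vertices covered if some edge contains it.  A set of q pairwise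
-- uncovered vertices could be added as an edge, so by maximality the graph of
-- covered pairs has no independent set of size q, and Turán's theorem gives
-- n² ≤ (q - 1)(n + 2 #covered).  Each edge covers q(q - 1)/2 pairs, whence
-- n² ≤ (q - 1)(n + e q(q - 1)), which is the bound.  Turán's theorem is proved
-- greedily: a vertex v of minimal degree d (closed neighbourhoods) contributes at
-- least d² adjacent ordered pairs, and the non-neighbours of v have a smaller
-- independence number.

module Submission where

open import Defs
open import Data.Bool using (if_then_else_)
open import Data.Empty using () renaming (⊥ to ⊥₀)
open import Data.Fin as Fin using (Fin; zero; suc)
open import Data.Fin.Properties using (suc-injective)
open import Data.Fin.Subset using (Subset; _∈_; _∪_; _∩_; ∣_∣; ⁅_⁆; inside; outside; ⊥)
open import Data.Fin.Subset.Properties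
  using (_∈?_; ∣⊥∣≡0; ∣⁅x⁆∣≡1; x∈⁅x⁆; x∈⁅y⁆⇒x≡y; x∈p∩q⁺; x∈p∩q⁻; x∈p∪q⁺; x∈p∪q⁻; Empty-unique; ∩-idem; ∩-comm; ∉⊥; p⊆q⇒∣p∣≤∣q∣)
open import Data.Integer as ℤ using (+_; +[1+_]; 1ℤ; _⊖_; +≤+)
import Data.Integer.Properties as ℤ
import Data.Integer.Tactic.RingSolver as ℤ-Solver
open import Data.List using (List; []; _∷_; _++_; map; filter; foldr; length; allFin; take; tabulate)
open import Data.List.Extrema.Nat using (argmin; argmin-sel; f[argmin]≤f[⊤]; f[argmin]≤f[xs])
open import Data.List.Membership.Propositional using () renaming (_∈_ to _∈ₗ_; _∉_ to _∉ₗ_)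
open import Data.List.Membership.Propositional.Properties using (∈-filter⁻)
open import Data.List.Properties using (length-tabulate; length-take; length-++; map-cong; map-++)
open import Data.List.Relation.Binary.Permutation.Propositional using (_↭_; ↭-refl; ↭-sym; ↭-trans; prep)
open import Data.List.Relation.Binary.Permutation.Propositional.Properties using (shift; ↭-length; map⁺)
open import Data.List.Relation.Binary.Sublist.Heterogeneous.Properties using (length-mono-≤)
open import Data.List.Relation.Binary.Sublist.Propositional.Properties using (filter-⊆; filter⁺)
open import Data.List.Relation.Unary.All as All using (All; []; _∷_)
open import Data.List.Relation.Unary.AllPairs as AllPairs using (AllPairs; []; _∷_)
open import Data.List.Relation.Unary.AllPairs.Properties using (take⁺)
open import Data.List.Relation.Unary.Any using (here; there)
open import Data.List.Relation.Unary.Unique.Propositional using (Unique)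
open import Data.Nat
  using (ℕ; zero; suc; _+_; _*_; _∸_; _^_; _⊔_; _≤_; _<_; z≤n; s≤s; s≤s⁻¹; NonZero; NonTrivial; nonTrivial⇒n>1; nonTrivial⇒nonZero; >-nonZero)
open import Data.Nat.ListAction using (sum)
open import Data.Nat.ListAction.Properties using (sum-++; sum-↭)
open import Data.Nat.Properties hiding (suc-injective)
open import Algebra.Properties.CommutativeSemigroup +-commutativeSemigroup using (x∙yz≈y∙xz; interchange)
open import Data.Nat.Tactic.RingSolver using (solve-∀)
open import Data.Product using (_×_; _,_; proj₁; proj₂; ∃-syntax)
open import Data.Rational as ℚ using (ℚ; mkℚ; 0ℚ; 1ℚ; _/_; toℚᵘ)
import Data.Rational.Properties as ℚ
open import Data.Rational.Unnormalised as ℚᵘ using (mkℚᵘ; *≡*; *≤*)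
import Data.Rational.Unnormalised.Properties as ℚᵘ
open import Data.Sum using (inj₁; inj₂)
open import Data.Vec using ([]; _∷_; here; there)
open import Function using (_∘_; const)
open import Level using (Level; 0ℓ)
open import Relation.Binary using (Rel) renaming (Decidable to Decidable₂)
open import Relation.Binary.PropositionalEquality
  using (_≡_; _≢_; refl; sym; trans; cong; cong₂; subst; subst₂; module ≡-Reasoning)
open import Relation.Nullary using (¬_; yes; no; does; contradiction)
open import Relation.Nullary.Decidable using (decidable-stable)
open import Relation.Unary using (Pred; Decidable)
open import Relation.Unary.Properties using (∁?)

private
  variable
    ℓ ℓ′ : Level
    X : Set ℓ
    n : ℕ

-- Turán's theorem

filter-++-∁-↭ : {P : Pred X ℓ′} (P? : Decidable P) (xs : List X) →
  xs ↭ filter P? xs ++ filter (∁? P?) xs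
filter-++-∁-↭ P? [] = ↭-refl
filter-++-∁-↭ P? (x ∷ xs) with P? x
... | yes _ = prep x (filter-++-∁-↭ P? xs)
... | no  _ = ↭-trans (prep x (filter-++-∁-↭ P? xs)) (↭-sym (shift x (filter P? xs) _))

length-filter-∁ : {P : Pred X ℓ′} (P? : Decidable P) (xs : List X) →
  length xs ≡ length (filter P? xs) + length (filter (∁? P?) xs)
length-filter-∁ P? xs = trans (↭-length (filter-++-∁-↭ P? xs)) (length-++ (filter P? xs))

sum-map-filter-∁ : {P : Pred X ℓ′} (P? : Decidable P) (f : X → ℕ) (xs : List X) →
  sum (map f xs) ≡ sum (map f (filter P? xs)) + sum (map f (filter (∁? P?) xs))
sum-map-filter-∁ P? f xs = begin
  sum (map f xs)                        ≡⟨ sum-↭ (map⁺ f (filter-++-∁-↭ P? xs)) ⟩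
  sum (map f (ys ++ zs))                ≡⟨ cong sum (map-++ f ys zs) ⟩
  sum (map f ys ++ map f zs)            ≡⟨ sum-++ (map f ys) (map f zs) ⟩
  sum (map f ys) + sum (map f zs)       ∎
  where
  open ≡-Reasoning
  ys = filter P? xs
  zs = filter (∁? P?) xs

sum-map-mono : {f g : X → ℕ} {xs : List X} →
  All (λ x → f x ≤ g x) xs → sum (map f xs) ≤ sum (map g xs)
sum-map-mono []         = z≤n
sum-map-mono (fx≤gx ∷ h) = +-mono-≤ fx≤gx (sum-map-mono h)

sum-map-const : (c : ℕ) (xs : List X) → sum (map (const c) xs) ≡ length xs * c
sum-map-const c []       = refl
sum-map-const c (x ∷ xs) = cong (_+_ c) (sum-map-const c xs)

sum-map-+ : (f g : X → ℕ) (xs : List X) →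
  sum (map (λ x → f x + g x) xs) ≡ sum (map f xs) + sum (map g xs)
sum-map-+ f g []       = refl
sum-map-+ f g (x ∷ xs) = trans (cong (_+_ (f x + g x)) (sum-map-+ f g xs)) (interchange (f x) (g x) _ _)

sum-map-indicator : {P : Pred X ℓ′} (P? : Decidable P) (c : ℕ) (xs : List X) →
  sum (map (λ x → if does (P? x) then c else 0) xs) ≡ length (filter P? xs) * c
sum-map-indicator P? c [] = refl
sum-map-indicator P? c (x ∷ xs) with P? x
... | yes _ = cong (_+_ c) (sum-map-indicator P? c xs)
... | no  _ = sum-map-indicator P? c xs

-- With the larger number written as the smaller plus `d`, the two sides differ by `d * d`.
2mn≤m²+n² : ∀ m n → 2 * (m * n) ≤ m * m + n * n
2mn≤m²+n² m n with ≤-total m n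
... | inj₁ m≤n = subst (λ k → 2 * (m * k) ≤ m * m + k * k) (m+[n∸m]≡n m≤n)
                   (≤-trans (m≤m+n _ _) (≤-reflexive (square m (n ∸ m))))
  where
  square : ∀ m d → 2 * (m * (m + d)) + d * d ≡ m * m + (m + d) * (m + d)
  square = solve-∀
... | inj₂ n≤m = subst (λ k → 2 * (k * n) ≤ k * k + n * n) (m+[n∸m]≡n n≤m)
                   (≤-trans (m≤m+n _ _) (≤-reflexive (square n (m ∸ n))))
  where
  square : ∀ n d → 2 * ((n + d) * n) + d * d ≡ (n + d) * (n + d) + n * n
  square = solve-∀

-- (s + 1) (d² + m²/s) - (d + m)² = (s d - m)² / s.
turán-step : ∀ s d m k t → m * m ≤ s * t → d * d + t ≤ k → (d + m) * (d + m) ≤ suc s * k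
-- For `s = 0` the first hypothesis forces `m = 0`. The case stands apart because m²/s makes no
-- sense here.
turán-step zero d zero k t _ d²+t≤k = begin
  (d + 0) * (d + 0) ≡⟨ cong (λ x → x * x) (+-identityʳ d) ⟩
  d * d             ≤⟨ m≤m+n (d * d) t ⟩
  d * d + t         ≤⟨ d²+t≤k ⟩
  k                 ≡⟨ +-identityʳ k ⟨
  1 * k             ∎
  where open ≤-Reasoning
-- Everything is multiplied by `s` to clear the quotient m²/s; the square (s d - m)² enters through
-- `2mn≤m²+n²`.
turán-step s@(suc _) d m k t m²≤st d²+t≤k = *-cancelˡ-≤ s (begin
  s * ((d + m) * (d + m))                                ≡⟨ expand s d m ⟩
  s * (d * d) + 2 * (s * d * m) + s * (m * m)            ≤⟨ +-monoˡ-≤ _ (+-monoʳ-≤ (s * (d * d)) (2mn≤m²+n² (s * d) m)) ⟩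
  s * (d * d) + (s * d * (s * d) + m * m) + s * (m * m)  ≡⟨ collect s d m ⟩
  suc s * (s * (d * d) + m * m)                          ≤⟨ *-monoʳ-≤ (suc s) (+-monoʳ-≤ (s * (d * d)) m²≤st) ⟩
  suc s * (s * (d * d) + s * t)                          ≡⟨ factor s (d * d) t ⟩
  s * (suc s * (d * d + t))                              ≤⟨ *-monoʳ-≤ s (*-monoʳ-≤ (suc s) d²+t≤k) ⟩
  s * (suc s * k)                                        ∎)
  where
  open ≤-Reasoning
  expand : ∀ s d m → s * ((d + m) * (d + m)) ≡ s * (d * d) + 2 * (s * d * m) + s * (m * m)
  expand = solve-∀
  collect : ∀ s d m → s * (d * d) + (s * d * (s * d) + m * m) + s * (m * m) ≡
                      (1 + s) * (s * (d * d) + m * m)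
  collect = solve-∀
  factor : ∀ s x t → (1 + s) * (s * x + s * t) ≡ s * ((1 + s) * (x + t))
  factor = solve-∀

module _ {R : Rel X ℓ′} (R? : Decidable₂ R) where

  degree : List X → X → ℕ
  degree xs u = length (filter (R? u) xs)

  -- The recursion is on the independence bound `k`, which drops by one when the neighbours of `v`
  -- are removed.
  turán : ∀ k (xs : List X) →
    (∀ {I} → All (_∈ₗ xs) I → AllPairs (λ u v → ¬ R u v) I → length I ≤ k) →
    length xs * length xs ≤ k * sum (map (degree xs) xs)
  turán k [] _ = z≤n
  -- A single vertex is already an independent list of length 1.
  turán zero (x ∷ xs) indep≤0 with () ← indep≤0 (here refl ∷ []) ([] ∷ [])
  turán (suc k) xs@(x ∷ xs′) indep≤k+1 =
    -- `length near` is `degree xs v` by definition, so the split into `near` and `far` writes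
    -- `length xs` as the d + m of `turán-step`.
    subst (λ l → l * l ≤ suc k * sum (map (degree xs) xs)) (sym (length-filter-∁ (R? v) xs))
      (turán-step k (degree xs v) (length far) _ _ (turán k far indep≤k) degrees)
    where
    v = argmin (degree xs) x xs′
    near = filter (R? v) xs
    far = filter (∁? (R? v)) xs

    v∈xs : v ∈ₗ xs
    v∈xs with argmin-sel (degree xs) x xs′
    ... | inj₁ v≡x   = here v≡x
    ... | inj₂ v∈xs′ = there v∈xs′

    v-min : All (λ u → degree xs v ≤ degree xs u) xs
    v-min = f[argmin]≤f[⊤] {f = degree xs} x xs′ ∷ f[argmin]≤f[xs] {f = degree xs} x xs′

    indep≤k : ∀ {I} → All (_∈ₗ far) I → AllPairs (λ u w → ¬ R u w) I → length I ≤ k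
    -- `AllPairs` compares earlier entries with later ones, so putting `v` in front asks for
    -- `¬ R v w`, which is what membership of `w` in `far` provides.
    indep≤k I⊆far indep = s≤s⁻¹ (indep≤k+1
      (v∈xs ∷ All.map (proj₁ ∘ ∈-filter⁻ (∁? (R? v))) I⊆far)
      (All.map (proj₂ ∘ ∈-filter⁻ (∁? (R? v)) {xs = xs}) I⊆far ∷ indep))

    degrees : degree xs v * degree xs v + sum (map (degree far) far) ≤ sum (map (degree xs) xs)
    degrees = begin
      degree xs v * degree xs v + sum (map (degree far) far)
        ≡⟨ cong (_+ sum (map (degree far) far)) (sum-map-const (degree xs v) near) ⟨
      sum (map (const (degree xs v)) near) + sum (map (degree far) far)
        -- On `near` the minimality of `v` applies; on `far`, counting neighbours in the sublist
        -- `far` instead of `xs` can only lower a degree.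
        ≤⟨ +-mono-≤
             (sum-map-mono (All.tabulate λ u∈near →
               All.lookup v-min (proj₁ (∈-filter⁻ (R? v) u∈near))))
             (sum-map-mono (All.universal (λ u →
               length-mono-≤ (filter⁺ (R? u) (R? u) (λ { refl p → p }) (filter-⊆ (∁? (R? v)) xs))) far)) ⟩
      sum (map (degree xs) near) + sum (map (degree xs) far)
        ≡⟨ sum-map-filter-∁ (R? v) (degree xs) xs ⟨
      sum (map (degree xs) xs) ∎
      where open ≤-Reasoning

-- Covered pairs in a linear hypergraph

length-filter-∈? : (A : Subset n) → length (filter (_∈? A) (allFin n)) ≡ ∣ A ∣
length-filter-∈? {n} A = go A (λ i → i) (_∈? A) (λ i → refl)
  where
  -- Past the first vertex the list is `tabulate (f ∘ suc)` while the subset is a tail, so the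
  -- induction keeps only the agreement of the decisions along `f`.
  go : ∀ {m} (B : Subset m) (f : Fin m → Fin n) {P : Pred (Fin n) 0ℓ} (P? : Decidable P) →
       (∀ i → does (P? (f i)) ≡ does (i ∈? B)) → length (filter P? (tabulate f)) ≡ ∣ B ∣
  go [] f P? eq = refl
  go (inside  ∷ B) f P? eq rewrite eq zero = cong suc (go B (f ∘ suc) P? (eq ∘ suc))
  go (outside ∷ B) f P? eq rewrite eq zero = go B (f ∘ suc) P? (eq ∘ suc)

∣p∪q∣+∣p∩q∣ : (p q : Subset n) → ∣ p ∪ q ∣ + ∣ p ∩ q ∣ ≡ ∣ p ∣ + ∣ q ∣
∣p∪q∣+∣p∩q∣ [] [] = refl
∣p∪q∣+∣p∩q∣ (inside  ∷ p) (inside  ∷ q) =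
  cong suc (trans (+-suc _ _) (trans (cong suc (∣p∪q∣+∣p∩q∣ p q)) (sym (+-suc _ _))))
∣p∪q∣+∣p∩q∣ (inside  ∷ p) (outside ∷ q) = cong suc (∣p∪q∣+∣p∩q∣ p q)
∣p∪q∣+∣p∩q∣ (outside ∷ p) (inside  ∷ q) = trans (cong suc (∣p∪q∣+∣p∩q∣ p q)) (sym (+-suc _ _))
∣p∪q∣+∣p∩q∣ (outside ∷ p) (outside ∷ q) = ∣p∪q∣+∣p∩q∣ p q

x∈p⇒1≤∣p∣ : ∀ {x : Fin n} {p} → x ∈ p → 1 ≤ ∣ p ∣
x∈p⇒1≤∣p∣ {x = x} {p} x∈p = subst (_≤ ∣ p ∣) (∣⁅x⁆∣≡1 x)
  (p⊆q⇒∣p∣≤∣q∣ λ y∈⁅x⁆ → subst (_∈ p) (sym (x∈⁅y⁆⇒x≡y x y∈⁅x⁆)) x∈p)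

subsingleton⇒∣p∣≤1 : (p : Subset n) → (∀ {x y} → x ∈ p → y ∈ p → x ≡ y) → ∣ p ∣ ≤ 1
subsingleton⇒∣p∣≤1 [] _ = z≤n
subsingleton⇒∣p∣≤1 {suc n} (inside ∷ p) unique
  rewrite Empty-unique {p = p} (λ (x , x∈p) → contradiction (unique here (there x∈p)) λ ())
  = s≤s (≤-reflexive (∣⊥∣≡0 n))
subsingleton⇒∣p∣≤1 (outside ∷ p) unique =
  subsingleton⇒∣p∣≤1 p λ x∈p y∈p → suc-injective (unique (there x∈p) (there y∈p))

fromList : List (Fin n) → Subset n
fromList = foldr (λ x p → ⁅ x ⁆ ∪ p) ⊥

∈-fromList⁻ : ∀ {x : Fin n} xs → x ∈ fromList xs → x ∈ₗ xs
∈-fromList⁻ [] x∈⊥ = contradiction x∈⊥ ∉⊥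
∈-fromList⁻ (y ∷ ys) x∈ with x∈p∪q⁻ ⁅ y ⁆ (fromList ys) x∈
... | inj₁ x∈⁅y⁆ = here (x∈⁅y⁆⇒x≡y y x∈⁅y⁆)
... | inj₂ x∈ys  = there (∈-fromList⁻ ys x∈ys)

∣fromList∣ : {xs : List (Fin n)} → Unique xs → ∣ fromList xs ∣ ≡ length xs
∣fromList∣ {n} [] = ∣⊥∣≡0 n
∣fromList∣ {n} {x ∷ xs} (x∉xs ∷ uniq) = begin
  ∣ ⁅ x ⁆ ∪ S ∣                     ≡⟨ +-identityʳ _ ⟨
  ∣ ⁅ x ⁆ ∪ S ∣ + 0                 ≡⟨ cong (_+_ ∣ ⁅ x ⁆ ∪ S ∣) disjoint ⟨
  ∣ ⁅ x ⁆ ∪ S ∣ + ∣ ⁅ x ⁆ ∩ S ∣     ≡⟨ ∣p∪q∣+∣p∩q∣ ⁅ x ⁆ S ⟩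
  ∣ ⁅ x ⁆ ∣ + ∣ S ∣                 ≡⟨ cong₂ _+_ (∣⁅x⁆∣≡1 x) (∣fromList∣ uniq) ⟩
  suc (length xs)                   ∎
  where
  open ≡-Reasoning
  S = fromList xs
  disjoint : ∣ ⁅ x ⁆ ∩ S ∣ ≡ 0
  disjoint = trans (cong ∣_∣ (Empty-unique λ (y , y∈) →
    let y∈⁅x⁆ , y∈S = x∈p∩q⁻ ⁅ x ⁆ S y∈
    in All.lookup x∉xs (∈-fromList⁻ xs y∈S) (sym (x∈⁅y⁆⇒x≡y x y∈⁅x⁆)))) (∣⊥∣≡0 n)

-- Symmetry handles entries met in the reverse order, and `x ≢ y` excludes an entry compared with
-- itself.
AllPairs-lookup : {R : Rel X ℓ′} {xs : List X} {x y : X} → (∀ {u v} → R u v → R v u) →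
  AllPairs R xs → x ∈ₗ xs → y ∈ₗ xs → x ≢ y → R x y
AllPairs-lookup R-sym (Rx ∷ _) (here refl) (here refl) x≢y = contradiction refl x≢y
AllPairs-lookup R-sym (Rx ∷ _) (here refl) (there y∈)  x≢y = All.lookup Rx y∈
AllPairs-lookup R-sym (Ry ∷ _) (there x∈)  (here refl) x≢y = R-sym (All.lookup Ry x∈)
AllPairs-lookup R-sym (_ ∷ ps) (there x∈)  (there y∈)  x≢y = AllPairs-lookup R-sym ps x∈ y∈ x≢y

-- The closed neighbourhood of u in the graph of the pairs covered by an edge.
N[_] : Fin n → List (Subset n) → Subset n
N[ u ] []      = ⁅ u ⁆
N[ u ] (A ∷ E) = if does (u ∈? A) then A ∪ N[ u ] E else N[ u ] E

u∈N[u] : (u : Fin n) (E : List (Subset n)) → u ∈ N[ u ] E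
u∈N[u] u [] = x∈⁅x⁆ u
u∈N[u] u (A ∷ E) with u ∈? A
... | yes u∈A = x∈p∪q⁺ (inj₁ u∈A)
... | no  _   = u∈N[u] u E

∈-N[] : ∀ {u v : Fin n} {A} {E : List (Subset n)} → A ∈ₗ E → u ∈ A → v ∈ A → v ∈ N[ u ] E
∈-N[] {u = u} {E = A ∷ E} (here refl) u∈A v∈A with u ∈? A
... | yes _  = x∈p∪q⁺ (inj₁ v∈A)
... | no u∉A = contradiction u∈A u∉A
∈-N[] {u = u} {E = B ∷ E} (there A∈E) u∈A v∈A with u ∈? B
... | yes _ = x∈p∪q⁺ (inj₂ (∈-N[] A∈E u∈A v∈A))
... | no  _ = ∈-N[] A∈E u∈A v∈A

-- If `u` lies in `A`, then it lies in both sets of the union, so by inclusion-exclusion the edge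
-- adds at most q - 1 new vertices.
∣N[]-∷∣ : ∀ {q} (u : Fin n) (A : Subset n) E → ∣ A ∣ ≡ q →
  ∣ N[ u ] (A ∷ E) ∣ ≤ (if does (u ∈? A) then q ∸ 1 else 0) + ∣ N[ u ] E ∣
∣N[]-∷∣ u A E refl with u ∈? A
... | no  _   = ≤-refl
... | yes u∈A = +-cancelʳ-≤ 1 _ _ (begin
  ∣ A ∪ N ∣ + 1           ≤⟨ +-monoʳ-≤ ∣ A ∪ N ∣ (x∈p⇒1≤∣p∣ (x∈p∩q⁺ (u∈A , u∈N[u] u E))) ⟩
  ∣ A ∪ N ∣ + ∣ A ∩ N ∣   ≡⟨ ∣p∪q∣+∣p∩q∣ A N ⟩
  ∣ A ∣ + ∣ N ∣           ≡⟨ cong (_+ ∣ N ∣) (m∸n+n≡m (x∈p⇒1≤∣p∣ u∈A)) ⟨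
  ∣ A ∣ ∸ 1 + 1 + ∣ N ∣   ≡⟨ swap (∣ A ∣ ∸ 1) ∣ N ∣ ⟩
  ∣ A ∣ ∸ 1 + ∣ N ∣ + 1   ∎)
  where
  open ≤-Reasoning
  N = N[ u ] E
  swap : ∀ a b → a + 1 + b ≡ a + b + 1
  swap = solve-∀

-- Double counting: each vertex contributes itself, and each edge adds at most q - 1 at each of its
-- q vertices.
Σ∣N[]∣ : ∀ {q} (E : List (Subset n)) → All (λ A → ∣ A ∣ ≡ q) E →
  sum (map (λ u → ∣ N[ u ] E ∣) (allFin n)) ≤ n + length E * (q * (q ∸ 1))
Σ∣N[]∣ {n} [] [] = ≤-reflexive (begin
  sum (map (λ u → ∣ ⁅ u ⁆ ∣) (allFin n))  ≡⟨ cong sum (map-cong ∣⁅x⁆∣≡1 (allFin n)) ⟩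
  sum (map (const 1) (allFin n))          ≡⟨ sum-map-const 1 (allFin n) ⟩
  length (allFin n) * 1                   ≡⟨ *-identityʳ _ ⟩
  length (allFin n)                       ≡⟨ length-tabulate (λ i → i) ⟩
  n                                       ≡⟨ +-identityʳ n ⟨
  n + 0                                   ∎)
  where open ≡-Reasoning
Σ∣N[]∣ {n} {q} (A ∷ E) (∣A∣≡q ∷ uniform) = begin
  sum (map (λ u → ∣ N[ u ] (A ∷ E) ∣) V)
    ≤⟨ sum-map-mono (All.universal (λ u → ∣N[]-∷∣ u A E ∣A∣≡q) V) ⟩
  sum (map (λ u → (if does (u ∈? A) then q ∸ 1 else 0) + ∣ N[ u ] E ∣) V)
    ≡⟨ sum-map-+ (λ u → if does (u ∈? A) then q ∸ 1 else 0) (λ u → ∣ N[ u ] E ∣) V ⟩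
  sum (map (λ u → if does (u ∈? A) then q ∸ 1 else 0) V) + sum (map (λ u → ∣ N[ u ] E ∣) V)
    ≤⟨ +-mono-≤ (≤-reflexive (sum-map-indicator (_∈? A) (q ∸ 1) V)) (Σ∣N[]∣ E uniform) ⟩
  length (filter (_∈? A) V) * (q ∸ 1) + (n + length E * (q * (q ∸ 1)))
    ≡⟨ cong (λ k → k * (q ∸ 1) + _) (trans (length-filter-∈? A) ∣A∣≡q) ⟩
  q * (q ∸ 1) + (n + length E * (q * (q ∸ 1)))
    ≡⟨ x∙yz≈y∙xz (q * (q ∸ 1)) n _ ⟩
  n + (q * (q ∸ 1) + length E * (q * (q ∸ 1))) ∎
  where
  open ≤-Reasoning
  V = allFin n

-- q pairwise uncovered vertices would form an edge that can be added.
maximal⇒independent<q : ∀ {q} {{_ : NonTrivial q}} (H : Hypergraph q n) → MaximalLinear H →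
  ∀ {I} → AllPairs (λ u v → ¬ v ∈ N[ u ] (edges H)) I → length I < q
maximal⇒independent<q {n} {q} H (linear , maximal) {I} indep =
  ≰⇒> λ q≤∣I∣ → maximal A (∣A∣≡q q≤∣I∣) (A∉E q≤∣I∣) linear′
  where
  -- `I` may be longer than an edge; any q of its vertices will do.
  J = take q I
  A = fromList J
  Uncovered : Rel (Fin n) _
  Uncovered u v = u ≢ v × (∀ B → B ∈ₗ edges H → u ∈ B → v ∈ B → ⊥₀)

  J-uncovered : AllPairs Uncovered J
  J-uncovered = take⁺ q (AllPairs.map
    (λ {u} v∉N → (λ { refl → v∉N (u∈N[u] u (edges H)) }) ,
                 λ _ B∈E u∈B v∈B → v∉N (∈-N[] B∈E u∈B v∈B)) indep)

  uncovered : ∀ {u v} → u ∈ A → v ∈ A → u ≢ v → Uncovered u v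
  uncovered u∈A v∈A = AllPairs-lookup
    (λ (u≢v , f) → u≢v ∘ sym , λ B B∈E v∈B u∈B → f B B∈E u∈B v∈B)
    J-uncovered (∈-fromList⁻ J u∈A) (∈-fromList⁻ J v∈A)

  ∣A∩B∣≤1 : ∀ {B} → B ∈ₗ edges H → ∣ A ∩ B ∣ ≤ 1
  -- Two distinct common vertices would be a pair covered by `B`.
  ∣A∩B∣≤1 {B} B∈E = subsingleton⇒∣p∣≤1 (A ∩ B) λ {x} {y} x∈ y∈ →
    let x∈A , x∈B = x∈p∩q⁻ A B x∈
        y∈A , y∈B = x∈p∩q⁻ A B y∈
    in decidable-stable (x Fin.≟ y) λ x≢y → proj₂ (uncovered x∈A y∈A x≢y) B B∈E x∈B y∈B

  ∣A∣≡q : q ≤ length I → ∣ A ∣ ≡ q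
  ∣A∣≡q q≤∣I∣ = trans (∣fromList∣ (AllPairs.map proj₁ J-uncovered))
                      (trans (length-take q I) (m≤n⇒m⊓n≡m q≤∣I∣))

  A∉E : q ≤ length I → A ∉ₗ edges H
  -- Otherwise `A ∩ A`, of size q ≥ 2, would have at most one element.
  A∉E q≤∣I∣ A∈E = <⇒≱ (nonTrivial⇒n>1 q)
    (subst (_≤ 1) (trans (cong ∣_∣ (∩-idem A)) (∣A∣≡q q≤∣I∣)) (∣A∩B∣≤1 A∈E))

  linear′ : Linear (A ∷ edges H)
  linear′ (here refl) (here refl) A≢A = contradiction refl A≢A
  linear′ (here refl) (there C∈E) _   = ∣A∩B∣≤1 C∈E
  linear′ {B} (there B∈E) (here refl) _ = subst (λ C → ∣ C ∣ ≤ 1) (∩-comm A B) (∣A∩B∣≤1 B∈E)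
  linear′ (there B∈E) (there C∈E) B≢C = linear B∈E C∈E B≢C

-- Turán's theorem with k = q - 1 for the relation `v ∈ N[ u ] (edges H)`, whose degrees are the
-- sizes of the closed neighbourhoods.
maximal⇒n²≤ : ∀ {q} {{_ : NonTrivial q}} (H : Hypergraph q n) → MaximalLinear H →
  n * n ≤ (q ∸ 1) * (n + e H * (q * (q ∸ 1)))
maximal⇒n²≤ {n} {q} H maximal = begin
  n * n
    ≡⟨ cong (λ k → k * k) (length-tabulate {n = n} (λ i → i)) ⟨
  length V * length V
    ≤⟨ turán _∼?_ (q ∸ 1) V (λ _ indep → <⇒≤pred (maximal⇒independent<q H maximal indep)) ⟩
  (q ∸ 1) * sum (map (degree _∼?_ V) V)
    ≡⟨ cong (λ ds → (q ∸ 1) * sum ds) (map-cong (λ u → length-filter-∈? (N[ u ] (edges H))) V) ⟩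
  (q ∸ 1) * sum (map (λ u → ∣ N[ u ] (edges H) ∣) V)
    ≤⟨ *-monoʳ-≤ (q ∸ 1) (Σ∣N[]∣ (edges H) (uniform H)) ⟩
  (q ∸ 1) * (n + e H * (q * (q ∸ 1))) ∎
  where
  open ≤-Reasoning
  V = allFin n
  _∼?_ : Decidable₂ (λ u v → v ∈ N[ u ] (edges H))
  u ∼? v = v ∈? N[ u ] (edges H)

-- Arithmetic of fractions

-- `_/_` on `ℚ` reduces to lowest terms. Unnormalised fractions keep `i` and `m`, so the rules below
-- become cross-multiplication.
toℚᵘ-/ : ∀ i m .{{_ : NonZero m}} → toℚᵘ (i / m) ℚᵘ.≃ i ℚᵘ./ m
toℚᵘ-/ i (suc m) = ℚ.toℚᵘ-fromℚᵘ (mkℚᵘ i m)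

/-≤-/⁺ : ∀ i j m n .{{_ : NonZero m}} .{{_ : NonZero n}} →
  i ℤ.* + n ℤ.≤ j ℤ.* + m → i / m ℚ.≤ j / n
/-≤-/⁺ i j m@(suc _) n@(suc _) h = ℚ.toℚᵘ-cancel-≤
  (ℚᵘ.≤-respˡ-≃ (ℚᵘ.≃-sym (toℚᵘ-/ i m)) (ℚᵘ.≤-respʳ-≃ (ℚᵘ.≃-sym (toℚᵘ-/ j n)) (*≤* h)))

/-≤-/⁻ : ∀ i j m n .{{_ : NonZero m}} .{{_ : NonZero n}} →
  i / m ℚ.≤ j / n → i ℤ.* + n ℤ.≤ j ℤ.* + m
/-≤-/⁻ i j m@(suc _) n@(suc _) h = ℚᵘ.drop-*≤*
  (ℚᵘ.≤-respˡ-≃ (toℚᵘ-/ i m) (ℚᵘ.≤-respʳ-≃ (toℚᵘ-/ j n) (ℚ.toℚᵘ-mono-≤ h)))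

/-≡-/ : ∀ i j m n .{{_ : NonZero m}} .{{_ : NonZero n}} →
  i ℤ.* + n ≡ j ℤ.* + m → i / m ≡ j / n
/-≡-/ i j (suc m) (suc n) h = ℚ.fromℚᵘ-cong {mkℚᵘ i m} {mkℚᵘ j n} (*≡* h)

/-*-/ : ∀ i j m n .{{_ : NonZero m}} .{{_ : NonZero n}} →
  (i / m) ℚ.* (j / n) ≡ ((i ℤ.* j) / (m * n)) {{m*n≢0 m n}}
/-*-/ i j m@(suc _) n@(suc _) = ℚ.toℚᵘ-injective (begin
  toℚᵘ ((i / m) ℚ.* (j / n))        ≈⟨ ℚ.toℚᵘ-homo-* (i / m) (j / n) ⟩
  toℚᵘ (i / m) ℚᵘ.* toℚᵘ (j / n)    ≈⟨ ℚᵘ.*-cong (toℚᵘ-/ i m) (toℚᵘ-/ j n) ⟩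
  (i ℤ.* j) ℚᵘ./ (m * n)            ≈⟨ toℚᵘ-/ (i ℤ.* j) (m * n) ⟨
  toℚᵘ ((i ℤ.* j) / (m * n))        ∎)
  where open ℚᵘ.≃-Reasoning

1-/ : ∀ i m .{{_ : NonZero m}} → 1ℚ ℚ.- i / m ≡ (+ m ℤ.- i) / m
1-/ i m@(suc _) = ℚ.toℚᵘ-injective (begin
  toℚᵘ (1ℚ ℚ.- i / m)                 ≈⟨ ℚ.toℚᵘ-homo-+ 1ℚ (ℚ.- (i / m)) ⟩
  toℚᵘ 1ℚ ℚᵘ.+ toℚᵘ (ℚ.- (i / m))     ≈⟨ ℚᵘ.+-congʳ (toℚᵘ 1ℚ) (ℚᵘ.≃-trans (ℚ.toℚᵘ-homo‿- (i / m)) (ℚᵘ.-‿cong (toℚᵘ-/ i m))) ⟩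
  toℚᵘ 1ℚ ℚᵘ.- i ℚᵘ./ m               ≈⟨ *≡* (cross i (+ m)) ⟩
  (+ m ℤ.- i) ℚᵘ./ m                  ≈⟨ toℚᵘ-/ (+ m ℤ.- i) m ⟨
  toℚᵘ ((+ m ℤ.- i) / m)              ∎)
  where
  open ℚᵘ.≃-Reasoning
  cross : ∀ i m → (+ 1 ℤ.* m ℤ.+ ℤ.- i ℤ.* + 1) ℤ.* m ≡ (m ℤ.- i) ℤ.* (+ 1 ℤ.* m)
  cross = ℤ-Solver.solve-∀

∣/∣ : ∀ i m .{{_ : NonZero m}} → ℚ.∣ i / m ∣ ≡ (+ ℤ.∣ i ∣) / m
∣/∣ i m@(suc _) = ℚ.toℚᵘ-injective (begin
  toℚᵘ ℚ.∣ i / m ∣          ≈⟨ ℚ.toℚᵘ-homo-∣-∣ (i / m) ⟩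
  ℚᵘ.∣ toℚᵘ (i / m) ∣       ≈⟨ ℚᵘ.∣-∣-cong (toℚᵘ-/ i m) ⟩
  (+ ℤ.∣ i ∣) ℚᵘ./ m        ≈⟨ toℚᵘ-/ (+ ℤ.∣ i ∣) m ⟨
  toℚᵘ ((+ ℤ.∣ i ∣) / m)    ∎)
  where open ℚᵘ.≃-Reasoning

-- A positive fraction is at least the reciprocal of its denominator; the field `d` stores that
-- denominator minus one, hence the witness `d`.
∃1/k≤ : ∀ ε → ℚ.Positive ε → ∃[ k ] + 1 / suc k ℚ.≤ ε
∃1/k≤ ε@(mkℚ +[1+ m ] d _) _ = d , subst (+ 1 / suc d ℚ.≤_) (ℚ.fromℚᵘ-toℚᵘ ε)
  (/-≤-/⁺ (+ 1) +[1+ m ] (suc d) (suc d) (ℤ.*-monoʳ-≤-nonNeg (+ suc d) {+ 1} {+[1+ m ]} (+≤+ (s≤s z≤n))))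

o[1]-intro : ∀ {δ} → (∀ k → ∃[ N ] ∀ n → N ≤ n → ℚ.∣ δ n ∣ ℚ.≤ + 1 / suc k) → o[1] δ
o[1]-intro {δ} h ε 0<ε =
  let k , 1/k≤ε = ∃1/k≤ ε (ℚ.positive 0<ε)
      N , ∣δ∣≤  = h k
  in N , λ n N≤n → subst (ℚ.∣ δ n ∣ ℚ.≤_) (sym (ℚ.*-identityʳ ε)) (ℚ.≤-trans (∣δ∣≤ n N≤n) 1/k≤ε)

∣/∣≤1/k : ∀ {i m} k .{{_ : NonZero m}} → suc k * ℤ.∣ i ∣ ≤ m → ℚ.∣ i / m ∣ ℚ.≤ + 1 / suc k
∣/∣≤1/k {i} {m} k h = subst (ℚ._≤ + 1 / suc k) (sym (∣/∣ i m)) (/-≤-/⁺ (+ ℤ.∣ i ∣) (+ 1) m (suc k)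
  (subst₂ ℤ._≤_ (trans (cong +_ (*-comm (suc k) ℤ.∣ i ∣)) (ℤ.pos-* ℤ.∣ i ∣ (suc k)))
    (sym (ℤ.*-identityˡ (+ m))) (+≤+ h)))

-- The choice ε = 1/(k + 1), with denominators cleared.
o[n]⇒k*q≤n : ∀ (q : ℕ → ℕ) → LittleO (λ n → ℕ→ℚ (q n)) ℕ→ℚ →
  ∀ k → ∃[ N ] ∀ n → N ≤ n → suc k * q n ≤ n
o[n]⇒k*q≤n q q=o[n] k =
  let N , h = q=o[n] (+ 1 / suc k) (ℚ.positive⁻¹ _ {{ℚ.normalize-pos 1 (suc k)}})
  in N , λ n N≤n → ℤ.drop‿+≤+ (subst₂ ℤ._≤_
       (trans (sym (ℤ.pos-* (q n) (suc k * 1))) (cong +_ (lhs k (q n))))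
       (trans (cong (ℤ._* + 1) (ℤ.*-identityˡ (+ n))) (ℤ.*-identityʳ (+ n)))
       (/-≤-/⁻ (+ q n) (+ 1 ℤ.* + n) 1 (suc k * 1) (subst₂ ℚ._≤_ (∣/∣ (+ q n) 1)
         (trans (cong ((+ 1 / suc k) ℚ.*_) (∣/∣ (+ n) 1)) (/-*-/ (+ 1) (+ n) (suc k) 1))
         (h n N≤n))))
  where
  lhs : ∀ k q → q * ((1 + k) * 1) ≡ (1 + k) * q
  lhs = solve-∀

-- Casts to the integers and a polynomial identity.

pos-^2 : ∀ m → + (m ^ 2) ≡ + m ℤ.* + m
pos-^2 m = trans (cong (λ x → + (m * x)) (*-identityʳ m)) (ℤ.pos-* m m)

pos-^3 : ∀ m → + (m ^ 3) ≡ + m ℤ.* (+ m ℤ.* + m)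
pos-^3 m = trans (ℤ.pos-* m (m ^ 2)) (cong (+ m ℤ.*_) (pos-^2 m))

-- Inequalities are proved in ℕ with the negative term moved across; this brings them back to ℤ.
m≤n+o⇒m-o≤n : ∀ {m} n o → m ≤ n + o → + m ℤ.- + o ℤ.≤ + n
m≤n+o⇒m-o≤n {m} n o m≤n+o = begin
  + m ℤ.- + o         ≤⟨ ℤ.+-monoˡ-≤ (ℤ.- + o) (+≤+ m≤n+o) ⟩
  + n ℤ.+ + o ℤ.- + o ≡⟨ cancel (+ n) (+ o) ⟩
  + n                 ∎
  where
  open ℤ.≤-Reasoning
  cancel : ∀ i j → i ℤ.+ j ℤ.- j ≡ i
  cancel = ℤ-Solver.solve-∀

-- The equations abstract from casts such as + (n * n), which Agda would normalise away.
cross-identity : ∀ n p {q n² np² pq² b qp² q³np²} → q ≡ 1ℤ ℤ.+ p →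
  n² ≡ n ℤ.* n → np² ≡ n ℤ.* (p ℤ.* p) → pq² ≡ p ℤ.* (q ℤ.* q) →
  b ≡ (1ℤ ℤ.+ + 2 ℤ.* p) ℤ.* n → qp² ≡ q ℤ.* (p ℤ.* p) →
  q³np² ≡ q ℤ.* (q ℤ.* q) ℤ.* (n ℤ.* (p ℤ.* p)) →
  n² ℤ.* (np² ℤ.- (pq² ℤ.- b)) ℤ.* qp² ≡ n ℤ.* (n ℤ.- q ℤ.+ 1ℤ) ℤ.* q³np²
cross-identity n p refl refl refl refl refl refl refl = ring-identity n p
  where
  -- Since p² + 2p + 1 = q², the bracket is q²(n - p), and both sides equal n² q³ p² (n - p).
  ring-identity : ∀ n p → let q = + 1 ℤ.+ p in
    n ℤ.* n ℤ.* (n ℤ.* (p ℤ.* p) ℤ.- (p ℤ.* (q ℤ.* q) ℤ.- (+ 1 ℤ.+ + 2 ℤ.* p) ℤ.* n)) ℤ.* (q ℤ.* (p ℤ.* p))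
    ≡ n ℤ.* (n ℤ.- q ℤ.+ + 1) ℤ.* (q ℤ.* (q ℤ.* q) ℤ.* (n ℤ.* (p ℤ.* p)))
  ring-identity = ℤ-Solver.solve-∀

-- The bound and its asymptotics

0≤ℕ→ℚ : ∀ m → 0ℚ ℚ.≤ ℕ→ℚ m
0≤ℕ→ℚ m = ℚ.nonNegative⁻¹ _ {{ℚ.normalize-nonNeg m 1}}

module _ (q : ℕ) {{_ : NonTrivial q}} where

  private
    p = q ∸ 1

    1≤p : 1 ≤ p
    1≤p = m<n⇒0<n∸m (nonTrivial⇒n>1 q)

    q≡1+p : q ≡ suc p
    q≡1+p = sym (m+[n∸m]≡n (<⇒≤ (nonTrivial⇒n>1 q)))

    +q≡1+p : + q ≡ 1ℤ ℤ.+ + p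
    +q≡1+p = cong +_ q≡1+p

    q≤2p : q ≤ 2 * p
    q≤2p = subst₂ _≤_ (sym q≡1+p) (cong (_+_ p) (sym (+-identityʳ p))) (+-monoˡ-≤ p 1≤p)

    instance
      p²≢0 : NonZero (p ^ 2)
      p²≢0 = m^n≢0 p 2 {{>-nonZero 1≤p}}

      q³≢0 : NonZero (q ^ 3)
      q³≢0 = m^n≢0 q 3 {{nonTrivial⇒nonZero q}}

      qp²≢0 : NonZero (q * p ^ 2)
      qp²≢0 = m*n≢0 q (p ^ 2) {{nonTrivial⇒nonZero q}}

  bound-0 : bound q 0 ≡ 0ℚ
  bound-0 = ℚ.0/n≡0 (q * p ^ 2)

  n²/q³-0 : ∀ x → n²/q³ q 0 ℚ.* x ≡ 0ℚ
  n²/q³-0 x = trans (cong (ℚ._* x) (ℚ.0/n≡0 (q ^ 3))) (ℚ.*-zeroˡ x)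

  -- As n - q + 1 = n - p, clearing denominators leaves n² - n p ≤ e q p², a rearrangement of
  -- `maximal⇒n²≤`.
  maximal⇒bound≤e : ∀ n (H : Hypergraph q n) → MaximalLinear H → bound q n ℚ.≤ ℕ→ℚ (e H)
  maximal⇒bound≤e n H maximal = /-≤-/⁺ (+ n ℤ.* (+ n ℤ.- + q ℤ.+ 1ℤ)) (+ e H) (q * p ^ 2) 1 (begin
    + n ℤ.* (+ n ℤ.- + q ℤ.+ 1ℤ) ℤ.* 1ℤ  ≡⟨ regroup (+ n) (+ p) +q≡1+p (ℤ.pos-* n n) (ℤ.pos-* n p) ⟩
    + (n * n) ℤ.- + (n * p)              ≤⟨ m≤n+o⇒m-o≤n (e H * (q * p ^ 2)) (n * p) n²≤ ⟩
    + (e H * (q * p ^ 2))                ≡⟨ ℤ.pos-* (e H) (q * p ^ 2) ⟩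
    + e H ℤ.* + (q * p ^ 2)              ∎)
    where
    open ℤ.≤-Reasoning
    n²≤ : n * n ≤ e H * (q * p ^ 2) + n * p
    n²≤ = ≤-trans (maximal⇒n²≤ H maximal) (≤-reflexive (lemma n p q (e H)))
      where
      lemma : ∀ n p q m → p * (n + m * (q * p)) ≡ m * (q * (p * (p * 1))) + n * p
      lemma = solve-∀

    regroup : ∀ n p {q n² np} → q ≡ 1ℤ ℤ.+ p → n² ≡ n ℤ.* n → np ≡ n ℤ.* p →
      n ℤ.* (n ℤ.- q ℤ.+ 1ℤ) ℤ.* 1ℤ ≡ n² ℤ.- np
    regroup n p refl refl refl = identity n p
      where
      identity : ∀ n p → n ℤ.* (n ℤ.- (+ 1 ℤ.+ p) ℤ.+ + 1) ℤ.* + 1 ≡ n ℤ.* n ℤ.- n ℤ.* p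
      identity = ℤ-Solver.solve-∀

  -- Enlarging both factors q - 1 in `maximal⇒n²≤` to q gives n² ≤ q n + e q³; division by q³ yields
  -- the relative error q/n.
  maximal⇒n²/q³[1-q/n]≤e : ∀ n {{_ : NonZero n}} (H : Hypergraph q n) →
    MaximalLinear H → n²/q³ q n ℚ.* (1ℚ ℚ.- + q / n) ℚ.≤ ℕ→ℚ (e H)
  maximal⇒n²/q³[1-q/n]≤e n H maximal = subst (ℚ._≤ ℕ→ℚ (e H)) (sym product)
    (/-≤-/⁺ (+ (n ^ 2) ℤ.* (+ n ℤ.- + q)) (+ e H) (q ^ 3 * n) 1 (begin
    + (n ^ 2) ℤ.* (+ n ℤ.- + q) ℤ.* 1ℤ   ≡⟨ regroup (+ (n ^ 2)) (+ n) (+ q) (ℤ.pos-* (n ^ 2) n) (ℤ.pos-* (n ^ 2) q) ⟩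
    + (n ^ 2 * n) ℤ.- + (n ^ 2 * q)      ≤⟨ m≤n+o⇒m-o≤n (e H * (q ^ 3 * n)) (n ^ 2 * q) n³≤ ⟩
    + (e H * (q ^ 3 * n))                ≡⟨ ℤ.pos-* (e H) (q ^ 3 * n) ⟩
    + e H ℤ.* + (q ^ 3 * n)              ∎))
    where
    instance
      q³n≢0 : NonZero (q ^ 3 * n)
      q³n≢0 = m*n≢0 (q ^ 3) n

    product : n²/q³ q n ℚ.* (1ℚ ℚ.- + q / n) ≡ (+ (n ^ 2) ℤ.* (+ n ℤ.- + q)) / (q ^ 3 * n)
    product = trans (cong (n²/q³ q n ℚ.*_) (1-/ (+ q) n)) (/-*-/ (+ (n ^ 2)) (+ n ℤ.- + q) (q ^ 3) n)

    n³≤ : n ^ 2 * n ≤ e H * (q ^ 3 * n) + n ^ 2 * q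
    n³≤ = begin
      n ^ 2 * n                                     ≡⟨ cong (λ x → n * x * n) (*-identityʳ n) ⟩
      n * n * n                                     ≤⟨ *-monoˡ-≤ n (maximal⇒n²≤ H maximal) ⟩
      (q ∸ 1) * (n + e H * (q * (q ∸ 1))) * n       ≤⟨ *-monoˡ-≤ n (*-mono-≤ (m∸n≤m q 1)
                                                         (+-monoʳ-≤ n (*-monoʳ-≤ (e H) (*-monoʳ-≤ q (m∸n≤m q 1))))) ⟩
      q * (n + e H * (q * q)) * n                   ≡⟨ lemma n q (e H) ⟩
      e H * (q ^ 3 * n) + n ^ 2 * q                 ∎
      where
      open ≤-Reasoning
      lemma : ∀ n q m → q * (n + m * (q * q)) * n ≡ m * (q * (q * (q * 1)) * n) + n * (n * 1) * q
      lemma = solve-∀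

    open ℤ.≤-Reasoning
    regroup : ∀ x n q {xn xq} → xn ≡ x ℤ.* n → xq ≡ x ℤ.* q → x ℤ.* (n ℤ.- q) ℤ.* 1ℤ ≡ xn ℤ.- xq
    regroup x n q refl refl = identity x n q
      where
      identity : ∀ x n q → x ℤ.* (n ℤ.- q) ℤ.* + 1 ≡ x ℤ.* n ℤ.- x ℤ.* q
      identity = ℤ-Solver.solve-∀

  module _ (n : ℕ) {{_ : NonZero n}} where

    private instance
      np²≢0 : NonZero (n * p ^ 2)
      np²≢0 = m*n≢0 n (p ^ 2)

    -- δ is read off from q² (n - p) = n p² (1 - δ).
    δ∞ : ℚ
    δ∞ = (+ (p * (q * q)) ℤ.- + (suc (2 * p) * n)) / (n * p ^ 2)

    -- `δ∞` is a difference of two nonnegative terms, so its absolute value is at most the larger.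
    -- The first is q²/(n p) ≤ 2q/n because q ≤ 2p, the second (1 + 2p)/p² ≤ 3/p because 1 ≤ p.
    ∣δ∞∣≤1/k : ∀ k → suc k * 2 * q ≤ n → suc k * 3 < q → ℚ.∣ δ∞ ∣ ℚ.≤ + 1 / suc k
    ∣δ∞∣≤1/k k 2kq≤n 3k<q = ∣/∣≤1/k {i} {n * p ^ 2} k (begin
      suc k * ℤ.∣ i ∣      ≡⟨ cong (λ j → suc k * ℤ.∣ j ∣) (ℤ.m-n≡m⊖n a b) ⟩
      suc k * ℤ.∣ a ⊖ b ∣  ≤⟨ *-monoʳ-≤ (suc k) (ℤ.∣m⊝n∣≤m⊔n a b) ⟩
      suc k * (a ⊔ b)      ≡⟨ *-distribˡ-⊔ (suc k) a b ⟩
      suc k * a ⊔ suc k * b ≤⟨ ⊔-lub ka≤np² kb≤np² ⟩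
      n * p ^ 2 ∎)
      where
      open ≤-Reasoning
      a = p * (q * q)
      b = suc (2 * p) * n
      i = + a ℤ.- + b
      ka≤np² : suc k * a ≤ n * p ^ 2
      ka≤np² = begin
        suc k * (p * (q * q))       ≤⟨ *-monoʳ-≤ (suc k) (*-monoʳ-≤ p (*-monoʳ-≤ q q≤2p)) ⟩
        suc k * (p * (q * (2 * p))) ≡⟨ lemma k p q ⟩
        suc k * 2 * q * p ^ 2       ≤⟨ *-monoˡ-≤ (p ^ 2) 2kq≤n ⟩
        n * p ^ 2                   ∎
        where
        lemma : ∀ k p q → (1 + k) * (p * (q * (2 * p))) ≡ (1 + k) * 2 * q * (p * (p * 1))
        lemma = solve-∀
      kb≤np² : suc k * b ≤ n * p ^ 2
      kb≤np² = begin
        suc k * ((1 + 2 * p) * n)     ≤⟨ *-monoʳ-≤ (suc k) (*-monoˡ-≤ n (+-monoˡ-≤ (2 * p) 1≤p)) ⟩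
        suc k * ((p + 2 * p) * n)     ≡⟨ lemma k p n ⟩
        -- The strict bound below q = p + 1 is a weak bound by p.
        n * (p * (suc k * 3))         ≤⟨ *-monoʳ-≤ n (*-monoʳ-≤ p (s≤s⁻¹ (subst (suc k * 3 <_) q≡1+p 3k<q))) ⟩
        n * (p * p)                   ≡⟨ cong (λ x → n * (p * x)) (*-identityʳ p) ⟨
        n * p ^ 2                     ∎
        where
        lemma : ∀ k p n → (1 + k) * ((p + 2 * p) * n) ≡ n * (p * ((1 + k) * 3))
        lemma = solve-∀

    -- By the choice of `δ∞` the product is n²/q³ times q²(n - p)/(n p²), that is n(n - p)/(q p²).
    bound≡ : bound q n ≡ n²/q³ q n ℚ.* (1ℚ ℚ.- δ∞)
    bound≡ = sym (begin
      n²/q³ q n ℚ.* (1ℚ ℚ.- δ∞)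
        ≡⟨ cong (n²/q³ q n ℚ.*_) (1-/ i (n * p ^ 2)) ⟩
      n²/q³ q n ℚ.* ((+ (n * p ^ 2) ℤ.- i) / (n * p ^ 2))
        ≡⟨ /-*-/ (+ (n ^ 2)) (+ (n * p ^ 2) ℤ.- i) (q ^ 3) (n * p ^ 2) ⟩
      (+ (n ^ 2) ℤ.* (+ (n * p ^ 2) ℤ.- i)) / (q ^ 3 * (n * p ^ 2))
        ≡⟨ /-≡-/ (+ (n ^ 2) ℤ.* (+ (n * p ^ 2) ℤ.- i)) (+ n ℤ.* (+ n ℤ.- + q ℤ.+ 1ℤ)) (q ^ 3 * (n * p ^ 2)) (q * p ^ 2) cross ⟩
      bound q n ∎)
      where
      open ≡-Reasoning
      i = + (p * (q * q)) ℤ.- + (suc (2 * p) * n)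
      instance
        q³np²≢0 : NonZero (q ^ 3 * (n * p ^ 2))
        q³np²≢0 = m*n≢0 (q ^ 3) (n * p ^ 2)
      cross : + (n ^ 2) ℤ.* (+ (n * p ^ 2) ℤ.- i) ℤ.* + (q * p ^ 2)
              ≡ + n ℤ.* (+ n ℤ.- + q ℤ.+ + 1) ℤ.* + (q ^ 3 * (n * p ^ 2))
      cross = cross-identity (+ n) (+ p) +q≡1+p (pos-^2 n) +np²
        (trans (ℤ.pos-* p (q * q)) (cong (+ p ℤ.*_) (ℤ.pos-* q q)))
        (trans (ℤ.pos-* (suc (2 * p)) n) (cong (λ x → (1ℤ ℤ.+ x) ℤ.* + n) (ℤ.pos-* 2 p)))
        (trans (ℤ.pos-* q (p ^ 2)) (cong (+ q ℤ.*_) (pos-^2 p)))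
        (trans (ℤ.pos-* (q ^ 3) (n * p ^ 2)) (cong₂ ℤ._*_ (pos-^3 q) +np²))
        where
        +np² = trans (ℤ.pos-* n (p ^ 2)) (cong (+ n ℤ.*_) (pos-^2 p))

-- One part of the error is of order q/n and vanishes as q = o(n); the other is of order 1/q and
-- vanishes as q tends to infinity. For constant q the ratio q²/(q - 1)² would stay away from 1.
bound-asymptotics : (q : ℕ → ℕ) {{_ : ∀ {n} → NonTrivial (q n)}} →
  LittleO (λ n → ℕ→ℚ (q n)) ℕ→ℚ → TendsToInfinity q →
  ∃[ δ ] (o[1] δ × (∀ n → bound (q n) n ≡ n²/q³ (q n) n ℚ.* (1ℚ ℚ.- δ n)))
bound-asymptotics q q=o[n] q→∞ = δ , o[1]-intro δ→0 , bound≡′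
  where
  δ : ℕ → ℚ
  δ zero      = 0ℚ
  δ n@(suc _) = δ∞ (q n) n

  δ→0 : ∀ k → ∃[ N ] ∀ n → N ≤ n → ℚ.∣ δ n ∣ ℚ.≤ + 1 / suc k
  δ→0 k =
    -- `suc (k + suc k)` is 2(k + 1), the factor that `∣δ∞∣≤1/k` asks for.
    let N₁ , q-small = o[n]⇒k*q≤n q q=o[n] (k + suc k)
        N₂ , q-large = q→∞ (suc (suc k * 3))
    -- The successor excludes n = 0, where `δ` has a default value.
    in suc (N₁ ⊔ N₂) , λ where
      n@(suc _) N<n → ∣δ∞∣≤1/k (q n) n k
        (subst (λ c → c * q n ≤ n) (double k) (q-small n (≤-trans (m≤m⊔n N₁ N₂) (<⇒≤ N<n))))
        (q-large n (≤-trans (m≤n⊔m N₁ N₂) (<⇒≤ N<n)))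
    where
    double : ∀ k → 1 + (k + (1 + k)) ≡ (1 + k) * 2
    double = solve-∀

  bound≡′ : ∀ n → bound (q n) n ≡ n²/q³ (q n) n ℚ.* (1ℚ ℚ.- δ n)
  bound≡′ zero      = trans (bound-0 (q 0)) (sym (n²/q³-0 (q 0) (1ℚ ℚ.- 0ℚ)))
  bound≡′ n@(suc _) = bound≡ (q n) n

-- The error is q/n, which is o(1) directly from q = o(n), and one `δ` serves all hypergraphs at
-- once.
edges-asymptotics : (q : ℕ → ℕ) {{_ : ∀ {n} → NonTrivial (q n)}} →
  LittleO (λ n → ℕ→ℚ (q n)) ℕ→ℚ →
  ∃[ δ ] (o[1] δ × (∀ n (H : Hypergraph (q n) n) →
    MaximalLinear H → n²/q³ (q n) n ℚ.* (1ℚ ℚ.- δ n) ℚ.≤ ℕ→ℚ (e H)))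
edges-asymptotics q q=o[n] = δ , o[1]-intro δ→0 , δ-bound
  where
  δ : ℕ → ℚ
  δ zero      = 0ℚ
  δ n@(suc _) = + q n / n

  δ→0 : ∀ k → ∃[ N ] ∀ n → N ≤ n → ℚ.∣ δ n ∣ ℚ.≤ + 1 / suc k
  δ→0 k =
    let N , q-small = o[n]⇒k*q≤n q q=o[n] k
    in suc N , λ where
      n@(suc _) N<n → ∣/∣≤1/k {+ q n} {n} k (q-small n (<⇒≤ N<n))

  δ-bound : ∀ n (H : Hypergraph (q n) n) → MaximalLinear H →
    n²/q³ (q n) n ℚ.* (1ℚ ℚ.- δ n) ℚ.≤ ℕ→ℚ (e H)
  δ-bound zero H _ = subst (ℚ._≤ ℕ→ℚ (e H)) (sym (n²/q³-0 (q 0) (1ℚ ℚ.- 0ℚ))) (0≤ℕ→ℚ (e H))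
  δ-bound n@(suc _) = maximal⇒n²/q³[1-q/n]≤e (q n) n

-- The asymptotic form is read in two ways for q = o(n): as an equality for the bound when q tends
-- to infinity, and as a lower bound on the number of edges.
proposition1 : (∀ (q n : ℕ) {{_ : NonTrivial q}} (H : Hypergraph q n) →
    MaximalLinear H → ℕ→ℚ (e H) ℚ.≥ bound q n)
    ×
    (∀ (q : ℕ → ℕ) {{_ : ∀ {n} → NonTrivial (q n)}} →
    LittleO (λ n → ℕ→ℚ (q n)) ℕ→ℚ →
    (TendsToInfinity q →
    ∃[ δ ] (o[1] δ × (∀ n → bound (q n) n ≡ n²/q³ (q n) n ℚ.* (1ℚ ℚ.- δ n))))
    ×
    (∃[ δ ] (o[1] δ × (∀ n (H : Hypergraph (q n) n) →
    MaximalLinear H → ℕ→ℚ (e H) ℚ.≥ n²/q³ (q n) n ℚ.* (1ℚ ℚ.- δ n)))))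
proposition1 =
  (λ q n H maximal → maximal⇒bound≤e q n H maximal) ,
  (λ q q=o[n] → bound-asymptotics q q=o[n] , edges-asymptotics q q=o[n])
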